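{- For every integer $n\geq 2$, the olive tree $O_n$ satisfies $\chi_L(O_n)=\left\lceil\log_3\left(\frac{n}{4}\right)\right\rceil+3$.
   Context: For a simple connected graph $G=(V,E)$, a $k$-coloring is a map $c:V\to\{1,\dots,k\}$ with adjacent vertices receiving different colors; $c^{ -1}(i)$ denotes the $i$-th color class, and $d(u,S)=\min_{v\in S}d(u,v)$. The color code of $v$ is $r_c(v)=(d(v,c^{ -1}(1)),\dots,d(v,c^{ -1}(k)))$. The coloring $c$ is a locating coloring if distinct vertices have distinct color codes. The locating chromatic number $\chi_L(G)$ is the least $k$ such that $G$ has a locating $k$-coloring. For $n\geq 2$ and positive integers $a_1,\dots,a_n$, the palm $S_n(a_1,\dots,a_n)$ is the tree obtained from the star with center (hub) $a_0$ and $n$ leaves by subdividing its $i$-th edge $a_i-1$ times, i.e. it consists of $n$ paths of lengths $a_1,\dots,a_n$ sharing the common endpoint $a_0$. The olive tree is $O_n=S_n(1,2,\dots,n)$. -}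

module Defs where

open import Data.Nat using (ℕ; zero; suc; _+_; _*_; _^_; _≤_)
open import Data.Fin using (Fin; toℕ)
open import Data.Product using (Σ; _×_; ∃)
open import Data.Sum using (_⊎_)
open import Relation.Binary.PropositionalEquality using (_≡_; _≢_)
open import Function.Bundles using (_⇔_)

record Graph : Set₁ where
  field
    V   : Set
    Adj : V → V → Set
open Graph public

data Walk (G : Graph) : V G → V G → ℕ → Set where
  []  : ∀ {u} → Walk G u u 0
  _∷_ : ∀ {u w v k} → Adj G u w → Walk G w v k → Walk G u v (suc k)

IsDist : (G : Graph) → V G → V G → ℕ → Set
IsDist G u v k = Walk G u v k × (∀ m → Walk G u v m → k ≤ m)

IsDistSet : (G : Graph) → V G → (V G → Set) → ℕ → Set
IsDistSet G u S k =
  (Σ (V G) λ v → S v × Walk G u v k) ×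
  (∀ v m → S v → Walk G u v m → k ≤ m)

IsColoring : (G : Graph) (k : ℕ) → (V G → Fin k) → Set
IsColoring G k c = ∀ u v → Adj G u v → c u ≢ c v

ColorClass : (G : Graph) (k : ℕ) → (V G → Fin k) → Fin k → V G → Set
ColorClass G k c i v = c v ≡ i

SameCode : (G : Graph) (k : ℕ) → (V G → Fin k) → V G → V G → Set
SameCode G k c u v =
  ∀ (i : Fin k) (d : ℕ) →
    IsDistSet G u (ColorClass G k c i) d ⇔ IsDistSet G v (ColorClass G k c i) d

IsLocatingColoring : (G : Graph) (k : ℕ) → (V G → Fin k) → Set
IsLocatingColoring G k c =
  IsColoring G k c × (∀ u v → SameCode G k c u v → u ≡ v)

HasLocatingColoring : Graph → ℕ → Set
HasLocatingColoring G k = Σ (V G → Fin k) λ c → IsLocatingColoring G k c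

IsLocChromNum : Graph → ℕ → Set
IsLocChromNum G m =
  HasLocatingColoring G m × (∀ k → HasLocatingColoring G k → m ≤ k)

-- Olive tree O_n = S_n(1,2,...,n).  Vertices: the hub a₀, and
-- node i j = the vertex on branch i+1 (which has length i+1) at distance j+1
-- from the hub.
data OliveV (n : ℕ) : Set where
  hub  : OliveV n
  node : (i : Fin n) → Fin (suc (toℕ i)) → OliveV n

data OliveEdge (n : ℕ) : OliveV n → OliveV n → Set where
  hub-first : (i : Fin n) (j : Fin (suc (toℕ i))) → toℕ j ≡ 0 →
              OliveEdge n hub (node i j)
  step      : (i : Fin n) (j j' : Fin (suc (toℕ i))) → toℕ j' ≡ suc (toℕ j) →
              OliveEdge n (node i j) (node i j')

OliveAdj : (n : ℕ) → OliveV n → OliveV n → Set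
OliveAdj n u v = OliveEdge n u v ⊎ OliveEdge n v u

Olive : ℕ → Graph
Olive n = record { V = OliveV n ; Adj = OliveAdj n }

-- IsCeilLog3Quarter n t : t = ⌈log₃(n/4)⌉, for n ≥ 2 (where this value is ≥ 0):
-- t is the least natural number with n/4 ≤ 3^t, i.e. n ≤ 4·3^t.
IsCeilLog3Quarter : ℕ → ℕ → Set
IsCeilLog3Quarter n t = n ≤ 4 * 3 ^ t × (∀ s → n ≤ 4 * 3 ^ s → t ≤ s)

{-# OPTIONS --safe #-}

-- Lower bound.  For a colour i other than that of the hub, let d be the distance
-- from the hub to the class of i.  From the first vertex of a branch this distance
-- is d - 1, d or d + 1, according to whether the branch carries i at depth d, else
-- at depth d + 1, or at neither; so these ternary signatures separate the branches.
-- If a colours occur next to the hub, a signature has value d - 1 at exactly one of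
-- them (the colour of its own first vertex), which leaves a 2^(a-1) 3^(k-1-a)
-- signatures for k colours, and this is at most 4 * 3^(k-3).
--
-- Upper bound.  The hub has colour 0 and branch p + 1 is coloured by alternating
-- 1010..., 2020..., 1212... or 2121..., according to p mod 4; the r-th ternary digit
-- of p / 4 decides whether the special colour 3 + r replaces the filler at depth
-- 2r + 3, at depth 2r + 4 or not at all.  Each branch misses one of the colours
-- 0, 1, 2, whose distance therefore runs through the hub and determines the depth.
-- Between vertices of equal depth, the colours 0, 1, 2 tell the four types apart
-- and the distances to the special colours recover the digits of p / 4.

module Submission where

open import Defs
open import Data.Nat using (ℕ; zero; suc; _+_; _*_; _^_; _≤_; _<_; _⊔_; z≤n; s≤s; s≤s⁻¹; ∣_-_∣; NonZero)
open import Data.Nat.Properties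
open import Data.Nat.DivMod using (_/_; _%_; _mod_; m≡m%n+[m/n]*n; m%n<n; m/n*n≤m; m/n<m)
open import Data.Nat.Tactic.RingSolver using (solve-∀)
open import Data.Bool using (Bool; true; false; if_then_else_)
open import Data.Fin as Fin using (Fin; zero; suc; toℕ; fromℕ<; inject₁; punchIn; punchOut)
import Data.Fin.Properties as Fin
open import Data.Fin.Patterns using (0F; 1F; 2F; 3F)
open import Data.List as List using (List; []; _∷_; _++_; length)
open import Data.List.Properties using (length-map; length-++)
open import Data.List.Membership.Propositional using (_∈_)
open import Data.List.Membership.Propositional.Properties using (∈-++⁺ˡ; ∈-++⁺ʳ; ∈-map⁺)
open import Data.List.Relation.Unary.Any using (here; index)
open import Data.List.Relation.Unary.Any.Properties using (lookup-index)
open import Data.Vec as Vec using (Vec; []; _∷_; tabulate)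
open import Data.Vec.Properties using (lookup∘tabulate)
open import Data.Product using (∃; _×_; _,_; proj₁; proj₂)
open import Data.Empty using (⊥-elim)
open import Data.Sum using (_⊎_; inj₁; inj₂; [_,_]′)
open import Function using (_∘_; _⇔_; mk⇔; Equivalence)
open import Relation.Nullary using (¬_; Dec; does; yes; no; contradiction)
open import Relation.Nullary.Decidable using (_×-dec_)
open import Relation.Binary.PropositionalEquality

open Equivalence using (to; from)

private
  variable
    n k : ℕ

-- Walks and distances in graphs

module _ {G : Graph} where

  infixr 5 _++ʷ_

  _++ʷ_ : ∀ {u v w k l} → Walk G u v k → Walk G v w l → Walk G u w (k + l)
  []       ++ʷ ys = ys
  (x ∷ xs) ++ʷ ys = x ∷ (xs ++ʷ ys)

  snocʷ : ∀ {u v w k} → Walk G u v k → Adj G v w → Walk G u w (suc k)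
  snocʷ []       e = e ∷ []
  snocʷ (x ∷ xs) e = x ∷ snocʷ xs e

  reverseʷ : (∀ {u v} → Adj G u v → Adj G v u) →
             ∀ {u v k} → Walk G u v k → Walk G v u k
  reverseʷ adj-sym []       = []
  reverseʷ adj-sym (x ∷ xs) = snocʷ (reverseʷ adj-sym xs) (adj-sym x)

  IsDistSet-unique : ∀ {u S k l} → IsDistSet G u S k → IsDistSet G u S l → k ≡ l
  IsDistSet-unique ((v , Sv , p) , k≤) ((w , Sw , q) , l≤) =
    ≤-antisym (k≤ w _ Sw q) (l≤ v _ Sv p)

  IsDistSet-⇔ : ∀ {u v S k} → IsDistSet G u S k → IsDistSet G v S k →
                ∀ d → IsDistSet G u S d ⇔ IsDistSet G v S d
  IsDistSet-⇔ {u} {v} {S} du dv d = mk⇔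
    (λ e → subst (IsDistSet G v S) (IsDistSet-unique du e) dv)
    (λ e → subst (IsDistSet G u S) (IsDistSet-unique dv e) du)

  IsDistSet-cong : ∀ {u S T d} → (∀ v → S v → T v) → (∀ v → T v → S v) →
                   IsDistSet G u S d → IsDistSet G u T d
  IsDistSet-cong S⊆T T⊆S ((v , Sv , p) , d≤) =
    (v , S⊆T v Sv , p) , λ w m Tw → d≤ w m (T⊆S w Tw)

SameCode-sym : ∀ {G k c u v} → SameCode G k c u v → SameCode G k c v u
SameCode-sym same i d = mk⇔ (from (same i d)) (to (same i d))

-- Distances in the olive tree

depth : OliveV n → ℕ
depth hub        = 0
depth (node i j) = suc (toℕ j)

Adj-sym : ∀ {u v} → OliveAdj n u v → OliveAdj n v u
Adj-sym (inj₁ e) = inj₂ e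
Adj-sym (inj₂ e) = inj₁ e

Edge-depth : ∀ {u v} → OliveEdge n u v → depth v ≡ suc (depth u)
Edge-depth (hub-first i j eq) = cong suc eq
Edge-depth (step i j j' eq)   = cong suc eq

Adj-depth : ∀ {u v} → OliveAdj n u v → depth u ≤ suc (depth v)
Adj-depth (inj₁ e) = m≤n⇒m≤1+n (≤-trans (n≤1+n _) (≤-reflexive (sym (Edge-depth e))))
Adj-depth (inj₂ e) = ≤-reflexive (Edge-depth e)

Walk-depthˡ : ∀ {u v} → Walk (Olive n) u v k → depth u ≤ k + depth v
Walk-depthˡ []       = ≤-refl
Walk-depthˡ (e ∷ es) = ≤-trans (Adj-depth e) (s≤s (Walk-depthˡ es))

Walk-depthʳ : ∀ {u v} → Walk (Olive n) u v k → depth v ≤ k + depth u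
Walk-depthʳ = Walk-depthˡ ∘ reverseʷ Adj-sym

∣-∣-least : ∀ {a b k} → a ≤ k + b → b ≤ k + a → ∣ a - b ∣ ≤ k
∣-∣-least {a} {b} {k} a≤ b≤ with ≤-total a b
... | inj₁ a≤b = subst (_≤ k) (sym (m≤n⇒∣m-n∣≡n∸m a≤b))
                   (m≤n+o⇒m∸n≤o b a (subst (b ≤_) (+-comm k a) b≤))
... | inj₂ b≤a = subst (_≤ k) (sym (trans (∣-∣-comm a b) (m≤n⇒∣m-n∣≡n∸m b≤a)))
                   (m≤n+o⇒m∸n≤o a b (subst (a ≤_) (+-comm k b) a≤))

Walk-within-≥ : ∀ {i i' : Fin n} {j j'} → Walk (Olive n) (node i j) (node i' j') k →
                ∣ toℕ j - toℕ j' ∣ ≤ k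
Walk-within-≥ w = ∣-∣-least (Walk-depthˡ w) (Walk-depthʳ w)

-- A branch can be left only through the hub. A step outwards only lengthens what remains, and once
-- the hub is reached the depth bound takes over.
Walk-leaving-≥ : ∀ {i : Fin n} {j v} → (∀ j' → v ≢ node i j') →
                 Walk (Olive n) (node i j) v k → suc (toℕ j) + depth v ≤ k
Walk-leaving-≥ v∉ [] = contradiction refl (v∉ _)
Walk-leaving-≥ v∉ (inj₁ (step i j j' eq) ∷ es) =
  m≤n⇒m≤1+n (≤-trans (+-monoˡ-≤ _ (≤-trans (n≤1+n _) (≤-reflexive (cong suc (sym eq)))))
            (Walk-leaving-≥ v∉ es))
Walk-leaving-≥ v∉ (inj₂ (hub-first i j eq) ∷ es) rewrite eq =
  s≤s (≤-trans (Walk-depthʳ es) (≤-reflexive (+-identityʳ _)))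
Walk-leaving-≥ v∉ (inj₂ (step i j' j eq) ∷ es) rewrite eq = s≤s (Walk-leaving-≥ v∉ es)

Walk-across-≥ : ∀ {i i' : Fin n} {j j'} → i ≢ i' → Walk (Olive n) (node i j) (node i' j') k →
                suc (toℕ j) + suc (toℕ j') ≤ k
Walk-across-≥ i≢i' = Walk-leaving-≥ (λ { _ refl → i≢i' refl })

outwards : ∀ (i : Fin n) d (j j' : Fin (suc (toℕ i))) → toℕ j' ≡ d + toℕ j →
           Walk (Olive n) (node i j) (node i j') d
outwards i zero    j j'       eq rewrite Fin.toℕ-injective eq = []
outwards i (suc d) j (suc j') eq =
  snocʷ (outwards i d j (inject₁ j') (trans (Fin.toℕ-inject₁ j') (suc-injective eq)))
        (inj₁ (step i (inject₁ j') (suc j') (cong suc (sym (Fin.toℕ-inject₁ j')))))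

hub⇝node : ∀ (i : Fin n) j → Walk (Olive n) hub (node i j) (suc (toℕ j))
hub⇝node i j = inj₁ (hub-first i zero refl) ∷ outwards i (toℕ j) zero j (sym (+-identityʳ _))

to-hub : ∀ (u : OliveV n) → Walk (Olive n) u hub (depth u)
to-hub hub        = []
to-hub (node i j) = reverseʷ Adj-sym (hub⇝node i j)

node⇝node : ∀ (i : Fin n) j j' → Walk (Olive n) (node i j) (node i j') ∣ toℕ j - toℕ j' ∣
node⇝node {n} i j j' with ≤-total (toℕ j) (toℕ j')
... | inj₁ j≤j' = subst (Walk (Olive n) _ _) (sym (m≤n⇒∣m-n∣≡n∸m j≤j'))
                    (outwards i _ j j' (sym (m∸n+n≡m j≤j')))
... | inj₂ j'≤j = subst (Walk (Olive n) _ _)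
                    (sym (trans (∣-∣-comm (toℕ j) (toℕ j')) (m≤n⇒∣m-n∣≡n∸m j'≤j)))
                    (reverseʷ Adj-sym (outwards i _ j' j (sym (m∸n+n≡m j'≤j))))

-- Counting branch signatures

join₂ : ∀ {m} (ys zs : List (Vec (Fin 3) m)) → List (Vec (Fin 3) (suc m))
join₂ ys zs = List.map (1F ∷_) ys ++ List.map (2F ∷_) zs

join₃ : ∀ {m} (xs ys zs : List (Vec (Fin 3) m)) → List (Vec (Fin 3) (suc m))
join₃ xs ys zs = List.map (0F ∷_) xs ++ join₂ ys zs

-- With near colours flagged true, "free" lists the signatures without an entry
-- 0F at a near colour, and "once" those with exactly one.
free : ∀ {m} → Vec Bool m → List (Vec (Fin 3) m)
free []          = [] ∷ []
free (true  ∷ N) = join₂ (free N) (free N)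
free (false ∷ N) = join₃ (free N) (free N) (free N)

once : ∀ {m} → Vec Bool m → List (Vec (Fin 3) m)
once []          = []
once (true  ∷ N) = join₃ (free N) (once N) (once N)
once (false ∷ N) = join₃ (once N) (once N) (once N)

∈-join₂ : ∀ {m} (ys zs : List (Vec (Fin 3) m)) x {v} →
          x ≢ 0F → v ∈ ys → v ∈ zs → (x ∷ v) ∈ join₂ ys zs
∈-join₂ ys zs 0F x≢0 _    _    = contradiction refl x≢0
∈-join₂ ys zs 1F _   v∈ys _    = ∈-++⁺ˡ (∈-map⁺ (1F ∷_) v∈ys)
∈-join₂ ys zs 2F _   _    v∈zs = ∈-++⁺ʳ (List.map (1F ∷_) ys) (∈-map⁺ (2F ∷_) v∈zs)

∈-join₃ : ∀ {m} (xs ys zs : List (Vec (Fin 3) m)) x {v} →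
          (x ≡ 0F → v ∈ xs) → (x ≢ 0F → v ∈ ys) → (x ≢ 0F → v ∈ zs) → (x ∷ v) ∈ join₃ xs ys zs
∈-join₃ xs ys zs 0F      p _ _ = ∈-++⁺ˡ (∈-map⁺ (0F ∷_) (p refl))
∈-join₃ xs ys zs (suc x) _ q r =
  ∈-++⁺ʳ (List.map (0F ∷_) xs) (∈-join₂ ys zs (suc x) (λ ()) (q (λ ())) (r (λ ())))

length-join₂ : ∀ {m} (ys zs : List (Vec (Fin 3) m)) → length (join₂ ys zs) ≡ length ys + length zs
length-join₂ ys zs =
  trans (length-++ (List.map (1F ∷_) ys)) (cong₂ _+_ (length-map _ ys) (length-map _ zs))

length-join₃ : ∀ {m} (xs ys zs : List (Vec (Fin 3) m)) →
               length (join₃ xs ys zs) ≡ length xs + (length ys + length zs)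
length-join₃ xs ys zs =
  trans (length-++ (List.map (0F ∷_) xs)) (cong₂ _+_ (length-map _ xs) (length-join₂ ys zs))

∈-free : ∀ {m} (N : Vec Bool m) (σ : Fin m → Fin 3) →
         (∀ i → Vec.lookup N i ≡ true → σ i ≢ 0F) → tabulate σ ∈ free N
∈-free []          σ σ≢0 = here refl
∈-free (true  ∷ N) σ σ≢0 = ∈-join₂ (free N) (free N) (σ zero) (σ≢0 zero refl) ih ih
  where ih = ∈-free N (σ ∘ suc) (σ≢0 ∘ suc)
∈-free (false ∷ N) σ σ≢0 = ∈-join₃ (free N) (free N) (free N) (σ zero) (λ _ → ih) (λ _ → ih) (λ _ → ih)
  where ih = ∈-free N (σ ∘ suc) (σ≢0 ∘ suc)

-- Up to `i₀` the tail still owes its near `0F` and stays in `once`; at `i₀` that entry is spent and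
-- the tail passes to `free`.
∈-once : ∀ {m} (N : Vec Bool m) (σ : Fin m → Fin 3) i₀ → Vec.lookup N i₀ ≡ true → σ i₀ ≡ 0F →
         (∀ i → i ≢ i₀ → Vec.lookup N i ≡ true → σ i ≢ 0F) → tabulate σ ∈ once N
∈-once (true ∷ N) σ zero _ σ≡0 σ≢0 =
  ∈-join₃ (free N) (once N) (once N) (σ zero) (λ _ → ∈-free N (σ ∘ suc) (λ i → σ≢0 (suc i) (λ ())))
    (contradiction σ≡0) (contradiction σ≡0)
∈-once (true ∷ N) σ (suc i₀) near σ≡0 σ≢0 =
  ∈-join₃ (free N) (once N) (once N) (σ zero) (λ eq → contradiction eq (σ≢0 zero (λ ()) refl))
    (λ _ → ih) (λ _ → ih)
  where ih = ∈-once N (σ ∘ suc) i₀ near σ≡0 (λ i i≢ → σ≢0 (suc i) (i≢ ∘ Fin.suc-injective))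
∈-once (false ∷ N) σ (suc i₀) near σ≡0 σ≢0 =
  ∈-join₃ (once N) (once N) (once N) (σ zero) (λ _ → ih) (λ _ → ih) (λ _ → ih)
  where ih = ∈-once N (σ ∘ suc) i₀ near σ≡0 (λ i i≢ → σ≢0 (suc i) (i≢ ∘ Fin.suc-injective))

#near : ∀ {m} → Vec Bool m → ℕ
#near []          = 0
#near (true  ∷ N) = suc (#near N)
#near (false ∷ N) = #near N

-- Each near colour admits two entries and each other colour three; the count 2^a 3^(m - a) is
-- stated with its denominator cleared.
length-free : ∀ {m} (N : Vec Bool m) → length (free N) * 3 ^ #near N ≡ 2 ^ #near N * 3 ^ m
length-free [] = refl
length-free {suc m} (true ∷ N)
  rewrite length-join₂ (free N) (free N) =
  trans (regroup (length (free N)) (3 ^ #near N))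
    (trans (cong (6 *_) (length-free N)) (split (2 ^ #near N) (3 ^ m)))
  where
  regroup : ∀ f p → (f + f) * (3 * p) ≡ 6 * (f * p)
  regroup = solve-∀
  split : ∀ q r → 6 * (q * r) ≡ 2 * q * (3 * r)
  split = solve-∀
length-free {suc m} (false ∷ N)
  rewrite length-join₃ (free N) (free N) (free N) =
  trans (regroup (length (free N)) (3 ^ #near N))
    (trans (cong (3 *_) (length-free N)) (split (2 ^ #near N) (3 ^ m)))
  where
  regroup : ∀ f p → (f + (f + f)) * p ≡ 3 * (f * p)
  regroup = solve-∀
  split : ∀ q r → 3 * (q * r) ≡ q * (3 * r)
  split = solve-∀

-- Fixing which near colour has the `0F` replaces its two free entries by one, so every choice
-- contributes half of `length (free N)`.
length-once : ∀ {m} (N : Vec Bool m) → 2 * length (once N) ≡ #near N * length (free N)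
length-once [] = refl
length-once (true ∷ N)
  rewrite length-join₃ (free N) (once N) (once N)
        | length-join₂ (free N) (free N) =
  trans (regroup (length (free N)) (length (once N)))
    (trans (cong (λ z → 2 * length (free N) + 2 * z) (length-once N)) (split (length (free N)) (#near N)))
  where
  regroup : ∀ f o → 2 * (f + (o + o)) ≡ 2 * f + 2 * (2 * o)
  regroup = solve-∀
  split : ∀ f a → 2 * f + 2 * (a * f) ≡ suc a * (f + f)
  split = solve-∀
length-once (false ∷ N)
  rewrite length-join₃ (once N) (once N) (once N)
        | length-join₃ (free N) (free N) (free N) =
  trans (regroup (length (once N)))
    (trans (cong (3 *_) (length-once N)) (split (length (free N)) (#near N)))
  where
  regroup : ∀ o → 2 * (o + (o + o)) ≡ 3 * (2 * o)
  regroup = solve-∀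
  split : ∀ f a → 3 * (a * f) ≡ a * (f + (f + f))
  split = solve-∀

-- Equality holds at a = 2 and a = 3, which is where the constant 4 comes from.
9a2^a≤8[3^a] : ∀ a → 9 * (a * 2 ^ a) ≤ 8 * 3 ^ a
9a2^a≤8[3^a] 0 = z≤n
9a2^a≤8[3^a] 1 = ≤ᵇ⇒≤ 18 24 _
9a2^a≤8[3^a] 2 = ≤-refl
-- From 2 on, the left side grows by the factor 2(a + 1)/a, at most 3; the added term is the exact
-- slack.
9a2^a≤8[3^a] (suc a@(suc (suc b))) = begin
  9 * (suc a * (2 * 2 ^ a))                    ≤⟨ m≤m+n _ (9 * (b * 2 ^ a)) ⟩
  9 * (suc a * (2 * 2 ^ a)) + 9 * (b * 2 ^ a)  ≡⟨ regroup b (2 ^ a) ⟩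
  3 * (9 * (a * 2 ^ a))                        ≤⟨ *-monoʳ-≤ 3 (9a2^a≤8[3^a] a) ⟩
  3 * (8 * 3 ^ a)                              ≡⟨ split (3 ^ a) ⟩
  8 * (3 * 3 ^ a)                              ∎
  where
  open ≤-Reasoning
  regroup : ∀ b p → 9 * ((3 + b) * (2 * p)) + 9 * (b * p) ≡ 3 * (9 * ((2 + b) * p))
  regroup = solve-∀
  split : ∀ p → 3 * (8 * p) ≡ 8 * (3 * p)
  split = solve-∀

-- With k = m + 1 colours this is the bound 4 * 3^(k - 3), the factor 9 avoiding a negative
-- exponent.
9[once]≤4[3^m] : ∀ {m} (N : Vec Bool m) → 9 * length (once N) ≤ 4 * 3 ^ m
9[once]≤4[3^m] {m} N = *-cancelʳ-≤ _ _ (2 * 3 ^ a) {{m*n≢0 2 (3 ^ a) {{_}} {{m^n≢0 3 a}}}} (begin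
  9 * o * (2 * 3 ^ a)        ≡⟨ e₁ o (3 ^ a) ⟩
  9 * (2 * o) * 3 ^ a        ≡⟨ cong (λ z → 9 * z * 3 ^ a) (length-once N) ⟩
  9 * (a * f) * 3 ^ a        ≡⟨ e₂ a f (3 ^ a) ⟩
  9 * a * (f * 3 ^ a)        ≡⟨ cong (9 * a *_) (length-free N) ⟩
  9 * a * (2 ^ a * 3 ^ m)    ≡⟨ e₃ a (2 ^ a) (3 ^ m) ⟩
  9 * (a * 2 ^ a) * 3 ^ m    ≤⟨ *-monoˡ-≤ (3 ^ m) (9a2^a≤8[3^a] a) ⟩
  8 * 3 ^ a * 3 ^ m          ≡⟨ e₄ (3 ^ a) (3 ^ m) ⟩
  4 * 3 ^ m * (2 * 3 ^ a)    ∎)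
  where
  open ≤-Reasoning
  a = #near N
  f = length (free N)
  o = length (once N)
  e₁ : ∀ o p → 9 * o * (2 * p) ≡ 9 * (2 * o) * p
  e₁ = solve-∀
  e₂ : ∀ a f p → 9 * (a * f) * p ≡ 9 * a * (f * p)
  e₂ = solve-∀
  e₃ : ∀ a q r → 9 * a * (q * r) ≡ 9 * (a * q) * r
  e₃ = solve-∀
  e₄ : ∀ p r → 8 * p * r ≡ 4 * r * (2 * p)
  e₄ = solve-∀

injective-∈⇒≤ : ∀ {A : Set} {n} (f : Fin n → A) (xs : List A) → (∀ i → f i ∈ xs) →
                (∀ i j → f i ≡ f j → i ≡ j) → n ≤ length xs
injective-∈⇒≤ f xs f∈ inj = Fin.injective⇒≤ {f = index ∘ f∈} λ {i} {j} eq →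
  inj i j (trans (lookup-index (f∈ i)) (trans (cong (List.lookup xs) eq) (sym (lookup-index (f∈ j)))))

-- The lower bound

module _ {P : ℕ → Set} (P? : ∀ d → Dec (P d)) where

  Least : ℕ → Set
  Least d = P d × (∀ e → P e → d ≤ e)

  least : ∀ N → (∀ d → P d → d < N) → (∃ Least) ⊎ (∀ d → ¬ P d)
  least N P<N = [ inj₁ , (λ none → inj₂ (λ d Pd → none d (P<N d Pd) Pd)) ]′ (search N)
    where
    search : ∀ N → (∃ Least) ⊎ (∀ d → d < N → ¬ P d)
    search zero = inj₂ (λ _ ())
    search (suc N) with search N | P? N
    ... | inj₁ found | _      = inj₁ found
    ... | inj₂ none  | yes PN = inj₁ (N , PN , λ e Pe → ≮⇒≥ (λ e<N → none e e<N Pe))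
    ... | inj₂ none  | no ¬PN = inj₂ λ d d<1+N Pd →
          [ (λ d<N → none d d<N Pd) , (λ { refl → ¬PN Pd }) ]′ (m≤n⇒m<n∨m≡n (s≤s⁻¹ d<1+N))

module LowerBound {n m} (c : OliveV n → Fin (suc m)) (loc : IsLocatingColoring (Olive n) (suc m) c) where

  root : Fin n → OliveV n
  root p = node p zero

  colour : Fin m → Fin (suc m)
  colour = punchIn (c hub)

  -- Positions are counted from the first vertex of a branch, so `d` is one less than the distance
  -- from the hub, and the three distances from that vertex read `d`, `d + 1`, `d + 2`.
  At : Fin m → ℕ → Fin n → Set
  At i d p = ∃ λ j → toℕ j ≡ d × c (node p j) ≡ colour i

  -- Abstract so that the with-abstractions over at? below find it unreduced.
  abstract
    at? : ∀ i d p → Dec (At i d p)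
    at? i d p = Fin.any? λ j → (toℕ j ≟ d) ×-dec (c (node p j) Fin.≟ colour i)

  At-bound : ∀ {i d} → ∃ (At i d) → d < n
  At-bound (p , j , refl , _) = ≤-trans (Fin.toℕ<n j) (Fin.toℕ<n p)

  first : ∀ i → (∃ (Least (λ d → Fin.any? (at? i d)))) ⊎ (∀ d → ¬ ∃ (At i d))
  first i = least (λ d → Fin.any? (at? i d)) n (λ _ → At-bound)

  near : Fin m → Bool
  near i with first i
  ... | inj₁ (zero , _) = true
  ... | _               = false

  level : Fin m → ℕ → Fin n → Fin 3
  level i d p = if does (at? i d p) then 0F else if does (at? i (suc d) p) then 1F else 2F

  sig : Fin n → Fin m → Fin 3
  sig p i with first i
  ... | inj₁ (d , _) = level i d p
  -- An absent colour separates no branches, so all of them get the same entry.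
  ... | inj₂ _       = 2F

  not-hub : ∀ p → c hub ≢ c (root p)
  not-hub p = proj₁ loc hub (root p) (inj₁ (hub-first p zero refl))

  dist-hub-colour : ∀ p → IsDistSet (Olive n) (root p) (ColorClass (Olive n) (suc m) c (c hub)) 1
  dist-hub-colour p = (hub , refl , to-hub (root p)) , λ where
    v .0 eq []      → contradiction (sym eq) (not-hub p)
    v _  _  (_ ∷ _) → s≤s z≤n

  -- The hub has another colour and every occurrence has position at least `d`, so reaching one on
  -- another branch takes at least `d + 2` steps. Only positions `d` and `d + 1` of the branch
  -- itself can do better.
  dist-level : ∀ i {d} → Least (λ d → Fin.any? (at? i d)) d → ∀ p →
               IsDistSet (Olive n) (root p) (ColorClass (Olive n) (suc m) c (colour i)) (d + toℕ (level i d p))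
  dist-level i {d} ((p₀ , j₀ , refl , c₀) , d≤) p with at? i d p | at? i (suc d) p
  ... | yes (j , j≡d , cj) | _ =
    (node p j , cj , outwards p _ zero j (trans j≡d (sym (trans (+-identityʳ _) (+-identityʳ d))))) , bound
    where
    bound : ∀ v k → c v ≡ colour i → Walk (Olive n) (root p) v k → d + 0 ≤ k
    bound hub k ch w = contradiction (sym ch) (Fin.punchInᵢ≢i _ i)
    bound (node p' j') k cv w = subst (_≤ k) (sym (+-identityʳ d))
      (≤-trans (d≤ (toℕ j') (p' , j' , refl , cv)) (Walk-within-≥ w))
  ... | no ¬at | yes (j , j≡1+d , cj) =
    (node p j , cj , outwards p _ zero j (trans j≡1+d (sym (trans (+-identityʳ _) (+-comm d 1))))) , bound
    where
    bound : ∀ v k → c v ≡ colour i → Walk (Olive n) (root p) v k → d + 1 ≤ k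
    bound hub k ch w = contradiction (sym ch) (Fin.punchInᵢ≢i _ i)
    bound (node p' j') k cv w with p Fin.≟ p' | d≤ (toℕ j') (p' , j' , refl , cv)
    ... | yes refl | d≤j' = subst (_≤ k) (+-comm 1 d)
      (≤-trans (≤∧≢⇒< d≤j' (λ d≡j' → ¬at (j' , sym d≡j' , cv))) (Walk-within-≥ w))
    ... | no p≢p'  | d≤j' = subst (_≤ k) (+-comm 1 d)
      (≤-trans (s≤s (m≤n⇒m≤1+n d≤j')) (Walk-across-≥ p≢p' w))
  ... | no ¬at | no ¬at⁺ =
    (node p₀ j₀ , c₀ , subst (Walk (Olive n) _ _) (+-comm 2 d) (to-hub (root p) ++ʷ hub⇝node p₀ j₀)) , bound
    where
    bound : ∀ v k → c v ≡ colour i → Walk (Olive n) (root p) v k → d + 2 ≤ k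
    bound hub k ch w = contradiction (sym ch) (Fin.punchInᵢ≢i _ i)
    bound (node p' j') k cv w with p Fin.≟ p' | d≤ (toℕ j') (p' , j' , refl , cv)
    ... | yes refl | d≤j' = subst (_≤ k) (+-comm 2 d)
      (≤-trans (≤∧≢⇒< (≤∧≢⇒< d≤j' (λ d≡j' → ¬at (j' , sym d≡j' , cv)))
                      (λ 1+d≡j' → ¬at⁺ (j' , sym 1+d≡j' , cv)))
               (Walk-within-≥ w))
    ... | no p≢p'  | d≤j' = subst (_≤ k) (+-comm 2 d)
      (≤-trans (s≤s (s≤s d≤j')) (Walk-across-≥ p≢p' w))

  -- The colour of the hub is at distance 1 from every first vertex, and an absent colour has no
  -- distance from any vertex; the signature settles the rest.
  sig⇒SameCode : ∀ p q → (∀ i → sig p i ≡ sig q i) → SameCode (Olive n) (suc m) c (root p) (root q)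
  sig⇒SameCode p q eq a with c hub Fin.≟ a
  ... | yes refl = IsDistSet-⇔ (dist-hub-colour p) (dist-hub-colour q)
  ... | no hub≢a = subst (λ a → ∀ d → IsDistSet (Olive n) (root p) (ColorClass (Olive n) (suc m) c a) d
                                    ⇔ IsDistSet (Olive n) (root q) (ColorClass (Olive n) (suc m) c a) d)
                     (Fin.punchIn-punchOut hub≢a) (go (punchOut hub≢a))
    where
    go : ∀ i d → IsDistSet (Olive n) (root p) (ColorClass (Olive n) (suc m) c (colour i)) d
               ⇔ IsDistSet (Olive n) (root q) (ColorClass (Olive n) (suc m) c (colour i)) d
    go i with first i | eq i
    ... | inj₁ (d , l) | lp≡lq = IsDistSet-⇔ (dist-level i l p)
            (subst (λ x → IsDistSet (Olive n) (root q) _ (d + toℕ x)) (sym lp≡lq) (dist-level i l q))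
    ... | inj₂ none    | _ = λ d → mk⇔ (⊥-elim ∘ absurd) (⊥-elim ∘ absurd)
      where
      absurd : ∀ {u d} → ¬ IsDistSet (Olive n) u (ColorClass (Olive n) (suc m) c (colour i)) d
      absurd ((hub , ch , _) , _)      = Fin.punchInᵢ≢i _ i (sym ch)
      absurd ((node p j , cv , _) , _) = none (toℕ j) (p , j , refl , cv)

  sig-injective : ∀ p q → (∀ i → sig p i ≡ sig q i) → p ≡ q
  sig-injective p q eq with refl ← proj₂ loc (root p) (root q) (sig⇒SameCode p q eq) = refl

  sig-own : ∀ p i → c (root p) ≡ colour i → near i ≡ true × sig p i ≡ 0F
  sig-own p i cp with first i
  ... | inj₂ none = contradiction (p , zero , refl , cp) (none 0)
  ... | inj₁ (suc d , _ , d≤) = contradiction (d≤ 0 (p , zero , refl , cp)) (λ ())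
  ... | inj₁ (zero , _) with at? i 0 p
  ...   | yes _  = refl , refl
  ...   | no ¬at = contradiction (zero , refl , cp) ¬at

  -- A near colour has least position 0, so the entry `0F` puts it on the first vertex itself. With
  -- `sig-own` this makes the near `0F` unique.
  sig-near : ∀ p i → near i ≡ true → sig p i ≡ 0F → c (root p) ≡ colour i
  sig-near p i near-i sig≡0 with first i
  ... | inj₁ (zero , _) with at? i 0 p | at? i 1 p
  ...   | yes (zero , _ , cp) | _    = cp
  ...   | no _                | yes _ = contradiction sig≡0 (λ ())
  ...   | no _                | no _  = contradiction sig≡0 (λ ())

  sig∈once : ∀ p → tabulate (sig p) ∈ once (tabulate near)
  sig∈once p = ∈-once (tabulate near) (sig p) i₀
    (trans (lookup∘tabulate near i₀) (proj₁ own)) (proj₂ own)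
    (λ i i≢i₀ near-i sig≡0 → i≢i₀ (Fin.punchIn-injective _ i i₀
      (trans (sym (sig-near p i (trans (sym (lookup∘tabulate near i)) near-i) sig≡0)) root≡i₀)))
    where
    i₀ = punchOut (not-hub p)
    root≡i₀ = sym (Fin.punchIn-punchOut (not-hub p))
    own = sig-own p i₀ root≡i₀

  bound : 9 * n ≤ 4 * 3 ^ m
  bound = ≤-trans (*-monoʳ-≤ 9 (injective-∈⇒≤ (tabulate ∘ sig) (once (tabulate near)) sig∈once inj))
                  (9[once]≤4[3^m] (tabulate near))
    where
    inj : ∀ p q → tabulate (sig p) ≡ tabulate (sig q) → p ≡ q
    inj p q eq = sig-injective p q λ i →
      trans (sym (lookup∘tabulate (sig p) i))
        (trans (cong (λ v → Vec.lookup v i) eq) (lookup∘tabulate (sig q) i))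

colours-≥ : ∀ {n t} → 2 ≤ n → IsCeilLog3Quarter n t → ∀ k → HasLocatingColoring (Olive n) k → t + 3 ≤ k
colours-≥ 2≤n _ zero (c , _) = contradiction (c hub) Fin.¬Fin0
-- For one and two colours the bound would give 18 ≤ 4 and 18 ≤ 12.
colours-≥ 2≤n _ (suc zero) (c , loc) =
  contradiction (≤-trans (*-monoʳ-≤ 9 2≤n) (LowerBound.bound c loc)) (<⇒≱ (≤ᵇ⇒≤ 5 18 _))
colours-≥ 2≤n _ (suc (suc zero)) (c , loc) =
  contradiction (≤-trans (*-monoʳ-≤ 9 2≤n) (LowerBound.bound c loc)) (<⇒≱ (≤ᵇ⇒≤ 13 18 _))
-- With `3 + k` colours, cancelling 9 leaves `n ≤ 4 * 3 ^ k`, to which minimality of `t` applies.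
colours-≥ {n} {t} 2≤n (_ , t≤) (suc (suc (suc k))) (c , loc) = subst (_≤ 3 + k) (+-comm 3 t) (+-monoʳ-≤ 3
  (t≤ k (*-cancelˡ-≤ 9 (≤-trans (LowerBound.bound c loc) (≤-reflexive (regroup (3 ^ k)))))))
  where
  regroup : ∀ p → 4 * (3 * (3 * p)) ≡ 9 * (4 * p)
  regroup = solve-∀

-- The colouring

missing : Fin 4 → ℕ
missing 0F = 2
missing 1F = 1
missing 2F = 0
missing 3F = 0

fill : Fin 4 → ℕ → ℕ
fill b (suc (suc j)) = fill b j
fill 0F 0 = 1
fill 0F 1 = 0
fill 1F 0 = 2
fill 1F 1 = 0
fill 2F 0 = 1
fill 2F 1 = 2
fill 3F 0 = 2
fill 3F 1 = 1

prompt? delayed? : Fin 3 → ℕ → ℕ → ℕ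
prompt? 1F s f = s
prompt? _  s f = f
delayed? 2F s f = s
delayed? _  s f = f

-- Each pair of slots spends one ternary digit of `a`, lowest first, on the special colour `s`.
-- Pairs have even length, so the fillers keep their phase.
slots : Fin 4 → (a s j : ℕ) → ℕ
slots b a s 0             = prompt? (a mod 3) s (fill b 0)
slots b a s 1             = delayed? (a mod 3) s (fill b 1)
slots b a s (suc (suc j)) = slots b (a / 3) (suc s) j

-- The colour of the vertex at distance j + 1 from the hub on branch p + 1.
hue : (p j : ℕ) → ℕ
hue p 0             = fill (p mod 4) 0
hue p 1             = fill (p mod 4) 1
hue p (suc (suc j)) = slots (p mod 4) (p / 4) 3 j

-- Special a r j: the r-th ternary digit of a is nonzero and places the r-th
-- special colour in slot j (slot 2r for digit 1, slot 2r + 1 for digit 2).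
data Special : (a r j : ℕ) → Set where
  prompt  : ∀ {a} → a mod 3 ≡ 1F → Special a 0 0
  delayed : ∀ {a} → a mod 3 ≡ 2F → Special a 0 1
  later   : ∀ {a r j} → Special (a / 3) r j → Special a (suc r) (2 + j)

-- Filler patterns

fill<3 : ∀ b j → fill b j < 3
fill<3 b (suc (suc j)) = fill<3 b j
fill<3 0F 0 = ≤ᵇ⇒≤ 2 3 _
fill<3 0F 1 = ≤ᵇ⇒≤ 1 3 _
fill<3 1F 0 = ≤ᵇ⇒≤ 3 3 _
fill<3 1F 1 = ≤ᵇ⇒≤ 1 3 _
fill<3 2F 0 = ≤ᵇ⇒≤ 2 3 _
fill<3 2F 1 = ≤ᵇ⇒≤ 3 3 _
fill<3 3F 0 = ≤ᵇ⇒≤ 3 3 _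
fill<3 3F 1 = ≤ᵇ⇒≤ 2 3 _

fill≢fill-suc : ∀ b j → fill b j ≢ fill b (suc j)
fill≢fill-suc b (suc (suc j)) = fill≢fill-suc b j
fill≢fill-suc 0F 0 ()
fill≢fill-suc 0F 1 ()
fill≢fill-suc 1F 0 ()
fill≢fill-suc 1F 1 ()
fill≢fill-suc 2F 0 ()
fill≢fill-suc 2F 1 ()
fill≢fill-suc 3F 0 ()
fill≢fill-suc 3F 1 ()

fill≢missing : ∀ b j → fill b j ≢ missing b
fill≢missing b (suc (suc j)) = fill≢missing b j
fill≢missing 0F 0 ()
fill≢missing 0F 1 ()
fill≢missing 1F 0 ()
fill≢missing 1F 1 ()
fill≢missing 2F 0 ()
fill≢missing 2F 1 ()
fill≢missing 3F 0 ()
fill≢missing 3F 1 ()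

fill-2≢3 : ∀ j → fill 2F j ≢ fill 3F j
fill-2≢3 0 ()
fill-2≢3 1 ()
fill-2≢3 (suc (suc j)) = fill-2≢3 j

fill-0≢0 : ∀ b → fill b 0 ≢ 0
fill-0≢0 0F ()
fill-0≢0 1F ()
fill-0≢0 2F ()
fill-0≢0 3F ()

missing<3 : ∀ b → missing b < 3
missing<3 0F = ≤-refl
missing<3 1F = s≤s (s≤s z≤n)
missing<3 2F = s≤s z≤n
missing<3 3F = s≤s z≤n

-- Special positions and ternary digits

Special-unique : ∀ {a r j j'} → Special a r j → Special a r j' → j ≡ j'
Special-unique (prompt _)  (prompt _)  = refl
Special-unique (prompt e)  (delayed f) = contradiction (trans (sym e) f) (λ ())
Special-unique (delayed e) (prompt f)  = contradiction (trans (sym e) f) (λ ())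
Special-unique (delayed _) (delayed _) = refl
Special-unique (later x)   (later y)   = cong (2 +_) (Special-unique x y)

-- On every branch the candidates for rank `r` are the adjacent slots 2r and 2r + 1.
Special-spread : ∀ {a a' r j j'} → Special a r j → Special a' r j' → j ≤ suc j'
Special-spread (prompt _)  _         = z≤n
Special-spread (delayed _) _         = s≤s z≤n
Special-spread (later x)   (later y) = s≤s (s≤s (Special-spread x y))

mod≢0⇒≥1 : ∀ a {x : Fin 3} → a mod 3 ≡ x → x ≢ 0F → 1 ≤ a
mod≢0⇒≥1 zero    eq x≢0 = contradiction (sym eq) x≢0
mod≢0⇒≥1 (suc a) eq x≢0 = s≤s z≤n

Special-rank : ∀ {a r j} → Special a r j → 3 ^ r ≤ a
Special-rank {a} (prompt e)  = mod≢0⇒≥1 a e (λ ())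
Special-rank {a} (delayed e) = mod≢0⇒≥1 a e (λ ())
Special-rank {a} {suc r} (later x) = begin
  3 * 3 ^ r    ≤⟨ *-monoʳ-≤ 3 (Special-rank x) ⟩
  3 * (a / 3)  ≡⟨ *-comm 3 (a / 3) ⟩
  a / 3 * 3    ≤⟨ m/n*n≤m a 3 ⟩
  a            ∎
  where open ≤-Reasoning

-- The slot grows linearly with the rank, but `a` exponentially. Slot `j` is position `j + 2` of its
-- branch, so the bound leaves room for one more vertex beyond the special one.
Special-fits : ∀ {a r j} → Special a r j → 3 + j ≤ a * 4
Special-fits {a} (prompt e)  = ≤-trans (n≤1+n 3) (*-monoˡ-≤ 4 (mod≢0⇒≥1 a e (λ ())))
Special-fits {a} (delayed e) = *-monoˡ-≤ 4 (mod≢0⇒≥1 a e (λ ()))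
Special-fits {a} {j = suc (suc j)} (later x) = begin
  5 + j              ≤⟨ m≤m+n (5 + j) (4 + 2 * j) ⟩
  5 + j + (4 + 2 * j) ≡⟨ e₁ j ⟩
  3 * (3 + j)        ≤⟨ *-monoʳ-≤ 3 (Special-fits x) ⟩
  3 * (a / 3 * 4)    ≡⟨ e₂ (a / 3) ⟩
  a / 3 * 3 * 4      ≤⟨ *-monoˡ-≤ 4 (m/n*n≤m a 3) ⟩
  a * 4              ∎
  where
  open ≤-Reasoning
  e₁ : ∀ j → 5 + j + (4 + 2 * j) ≡ 3 * (3 + j)
  e₁ = solve-∀
  e₂ : ∀ q → 3 * (q * 4) ≡ q * 3 * 4
  e₂ = solve-∀

mod-/-injective : ∀ d .{{_ : NonZero d}} {a a'} → a mod d ≡ a' mod d → a / d ≡ a' / d → a ≡ a'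
mod-/-injective d {a} {a'} mods quots = begin
  a                    ≡⟨ m≡m%n+[m/n]*n a d ⟩
  a % d + a / d * d    ≡⟨ cong₂ (λ r q → r + q * d) rems quots ⟩
  a' % d + a' / d * d  ≡⟨ m≡m%n+[m/n]*n a' d ⟨
  a'                   ∎
  where
  open ≡-Reasoning
  rems : a % d ≡ a' % d
  rems = trans (sym (Fin.toℕ-fromℕ< (m%n<n a d))) (trans (cong toℕ mods) (Fin.toℕ-fromℕ< (m%n<n a' d)))

-- The special positions spell out the ternary digits: the lowest digits are compared first, then
-- `later` is stripped to compare the quotients by 3.
Special-injective : ∀ {a a'} → (∀ {r j} → Special a r j → Special a' r j) →
                    (∀ {r j} → Special a' r j → Special a r j) → a ≡ a'
Special-injective {a} {a'} f g = go (a + a') (m≤m+n a a') (m≤n+m a' a) f g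
  where
  smaller : ∀ {N} a → a ≤ suc N → a / 3 ≤ N
  smaller zero    _   = z≤n
  smaller (suc a) a≤N = s≤s⁻¹ (≤-trans (m/n<m (suc a) 3 (s≤s (s≤s z≤n))) a≤N)

  unlater : ∀ {a r j} → Special a (suc r) (2 + j) → Special (a / 3) r j
  unlater (later x) = x

  is-prompt : ∀ {a} → Special a 0 0 → a mod 3 ≡ 1F
  is-prompt (prompt e) = e

  is-delayed : ∀ {a} → Special a 0 1 → a mod 3 ≡ 2F
  is-delayed (delayed e) = e

  same-mod : ∀ {a a'} → (∀ {r j} → Special a r j → Special a' r j) →
             (∀ {r j} → Special a' r j → Special a r j) → a mod 3 ≡ a' mod 3
  same-mod {a} {a'} f g with a mod 3 in e | a' mod 3 in e'
  ... | 0F | 0F = refl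
  ... | 1F | _  = trans (sym (is-prompt (f (prompt e)))) e'
  ... | 2F | _  = trans (sym (is-delayed (f (delayed e)))) e'
  ... | 0F | 1F = trans (sym e) (is-prompt (g (prompt e')))
  ... | 0F | 2F = trans (sym e) (is-delayed (g (delayed e')))

  go : ∀ N {a a'} → a ≤ N → a' ≤ N → (∀ {r j} → Special a r j → Special a' r j) →
       (∀ {r j} → Special a' r j → Special a r j) → a ≡ a'
  go zero z≤n z≤n f g = refl
  go (suc N) {a} {a'} a≤ a'≤ f g = mod-/-injective 3 (same-mod f g)
    (go N (smaller a a≤) (smaller a' a'≤) (unlater ∘ f ∘ later) (unlater ∘ g ∘ later))

-- Colours along a branch

slots-Special : ∀ {b a r j} s → Special a r j → slots b a s j ≡ r + s
slots-Special s (prompt e)  rewrite e = refl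
slots-Special s (delayed e) rewrite e = refl
slots-Special {r = suc r} s (later x) = trans (slots-Special (suc s) x) (+-suc r s)

slots-view : ∀ b a s j → slots b a s j ≡ fill b j ⊎ ∃ λ r → Special a r j × slots b a s j ≡ r + s
slots-view b a s 0 with a mod 3 in e
... | 0F = inj₁ refl
... | 1F = inj₂ (0 , prompt e , refl)
... | 2F = inj₁ refl
slots-view b a s 1 with a mod 3 in e
... | 0F = inj₁ refl
... | 1F = inj₁ refl
... | 2F = inj₂ (0 , delayed e , refl)
slots-view b a s (suc (suc j)) with slots-view b (a / 3) (suc s) j
... | inj₁ eq            = inj₁ eq
... | inj₂ (r , x , eq)  = inj₂ (suc r , later x , trans eq (+-suc r s))

-- The other slot of the pair holds a filler: it follows a prompt special colour and precedes a
-- delayed one.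
Special-neighbour : ∀ {b a r j} s → Special a r j →
  slots b a s (suc j) ≡ fill b (suc j) ⊎ ∃ λ i → j ≡ suc i × slots b a s i ≡ fill b i
Special-neighbour s (prompt e)  rewrite e = inj₁ refl
Special-neighbour {b} s (delayed e) = inj₂ (0 , refl , cong (λ x → prompt? x s (fill b 0)) e)
Special-neighbour s (later x) with Special-neighbour (suc s) x
... | inj₁ eq              = inj₁ eq
... | inj₂ (i , refl , eq) = inj₂ (2 + i , refl , eq)

SpecialAt : (p r j : ℕ) → Set
SpecialAt p r j = ∃ λ i → j ≡ 2 + i × Special (p / 4) r i

hue-Special : ∀ {p r j} → SpecialAt p r j → hue p j ≡ r + 3
hue-Special (i , refl , x) = slots-Special 3 x

hue-view : ∀ p j → hue p j ≡ fill (p mod 4) j ⊎ ∃ λ r → SpecialAt p r j × hue p j ≡ r + 3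
hue-view p 0 = inj₁ refl
hue-view p 1 = inj₁ refl
hue-view p (suc (suc j)) with slots-view (p mod 4) (p / 4) 3 j
... | inj₁ eq           = inj₁ eq
... | inj₂ (r , x , eq) = inj₂ (r , (j , refl , x) , eq)

fill≢special : ∀ b j r → fill b j ≢ r + 3
fill≢special b j r eq = <⇒≱ (fill<3 b j) (subst (3 ≤_) (sym eq) (m≤n+m 3 r))

hue-special : ∀ {p j} r → hue p j ≡ r + 3 → SpecialAt p r j
hue-special {p} {j} r eq with hue-view p j
... | inj₁ eq'            = contradiction (trans (sym eq') eq) (fill≢special (p mod 4) j r)
... | inj₂ (r' , x , eq') with refl ← +-cancelʳ-≡ 3 r r' (trans (sym eq) eq') = x

SpecialAt-unique : ∀ {p r j j'} → SpecialAt p r j → SpecialAt p r j' → j ≡ j'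
SpecialAt-unique (_ , refl , x) (_ , refl , y) = cong (2 +_) (Special-unique x y)

SpecialAt-spread : ∀ {p p' r j j'} → SpecialAt p r j → SpecialAt p' r j' → j ≤ suc j'
SpecialAt-spread (_ , refl , x) (_ , refl , y) = s≤s (s≤s (Special-spread x y))

SpecialAt-fits : ∀ {p r j} → SpecialAt p r j → suc j ≤ p
SpecialAt-fits {p} (_ , refl , x) = ≤-trans (Special-fits x) (m/n*n≤m p 4)

hue-proper : ∀ p j → hue p j ≢ hue p (suc j)
hue-proper p j eq with hue-view p j | hue-view p (suc j)
... | inj₁ e           | inj₁ e'            = fill≢fill-suc (p mod 4) j (trans (sym e) (trans eq e'))
... | inj₁ e           | inj₂ (r , _ , e')  = fill≢special (p mod 4) j r (trans (sym e) (trans eq e'))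
... | inj₂ (r , x , e) | _ =
  contradiction (SpecialAt-unique {p} x (hue-special {p} {suc j} r (trans (sym eq) e))) (1+n≢n ∘ sym)

hue≢missing : ∀ p j → hue p j ≢ missing (p mod 4)
hue≢missing p j eq with hue-view p j
... | inj₁ e           = fill≢missing (p mod 4) j (trans (sym e) eq)
... | inj₂ (r , _ , e) = <⇒≱ (missing<3 (p mod 4)) (subst (3 ≤_) (trans (sym e) eq) (m≤n+m 3 r))

-- A special colour of rank `r` forces `4 * 3 ^ r ≤ p`, so only ranks below `t` occur. This is where
-- the logarithm enters the upper bound.
hue< : ∀ {p t} j → p < 4 * 3 ^ t → hue p j < t + 3
hue< {p} {t} j p<4[3^t] with hue-view p j
... | inj₁ e = subst (_< t + 3) (sym e) (≤-trans (fill<3 (p mod 4) j) (m≤n+m 3 t))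
... | inj₂ (r , (_ , _ , x) , e) = subst (_< t + 3) (sym e) (+-monoˡ-< 3 (≰⇒> λ t≤r → <⇒≱ p<4[3^t] (begin
  4 * 3 ^ t    ≤⟨ *-monoʳ-≤ 4 (^-monoʳ-≤ 3 t≤r) ⟩
  4 * 3 ^ r    ≤⟨ *-monoʳ-≤ 4 (Special-rank x) ⟩
  4 * (p / 4)  ≡⟨ *-comm 4 (p / 4) ⟩
  p / 4 * 4    ≤⟨ m/n*n≤m p 4 ⟩
  p            ∎)))
  where open ≤-Reasoning

-- The clause `b' ≢ 0F` secures a second vertex: the only branch with a single vertex is the first
-- one, whose type is `0F`.
fill-contains : ∀ b b' → missing b ≢ 0 → missing b ≢ missing b' →
                fill b' 0 ≡ missing b ⊎ (b' ≢ 0F × fill b' 1 ≡ missing b)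
fill-contains 0F 0F _ ≢  = contradiction refl ≢
fill-contains 0F 1F _ _  = inj₁ refl
fill-contains 0F 2F _ _  = inj₂ ((λ ()) , refl)
fill-contains 0F 3F _ _  = inj₁ refl
fill-contains 1F 0F _ _  = inj₁ refl
fill-contains 1F 1F _ ≢  = contradiction refl ≢
fill-contains 1F 2F _ _  = inj₁ refl
fill-contains 1F 3F _ _  = inj₂ ((λ ()) , refl)
fill-contains 2F _  ≢0 _ = contradiction refl ≢0
fill-contains 3F _  ≢0 _ = contradiction refl ≢0

hue-contains : ∀ b q → missing b ≢ 0 → missing b ≢ missing (q mod 4) →
               ∃ λ e → e ≤ 1 × e ≤ q × hue q e ≡ missing b
hue-contains b q ≢0 ≢m with fill-contains b (q mod 4) ≢0 ≢m
... | inj₁ eq           = 0 , z≤n , z≤n , eq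
... | inj₂ (q≢0 , eq)   = 1 , ≤-refl , n≢0⇒n>0 (λ { refl → q≢0 refl }) , eq

same-missing : ∀ b b' → (missing b ≢ 0 → missing b ≡ missing b') →
               (missing b' ≢ 0 → missing b' ≡ missing b) →
               b ≡ b' ⊎ (b ≡ 2F × b' ≡ 3F) ⊎ (b ≡ 3F × b' ≡ 2F)
same-missing 0F 0F _ _ = inj₁ refl
same-missing 1F 1F _ _ = inj₁ refl
same-missing 2F 2F _ _ = inj₁ refl
same-missing 3F 3F _ _ = inj₁ refl
same-missing 2F 3F _ _ = inj₂ (inj₁ (refl , refl))
same-missing 3F 2F _ _ = inj₂ (inj₂ (refl , refl))
same-missing 0F 1F f _ = contradiction (f (λ ())) (λ ())
same-missing 0F 2F f _ = contradiction (f (λ ())) (λ ())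
same-missing 0F 3F f _ = contradiction (f (λ ())) (λ ())
same-missing 1F 0F f _ = contradiction (f (λ ())) (λ ())
same-missing 1F 2F f _ = contradiction (f (λ ())) (λ ())
same-missing 1F 3F f _ = contradiction (f (λ ())) (λ ())
same-missing 2F 0F _ g = contradiction (g (λ ())) (λ ())
same-missing 2F 1F _ g = contradiction (g (λ ())) (λ ())
same-missing 3F 0F _ g = contradiction (g (λ ())) (λ ())
same-missing 3F 1F _ g = contradiction (g (λ ())) (λ ())

∣j-1+m∣≢∣j-m∣ : ∀ j m → ∣ j - suc m ∣ ≢ ∣ j - m ∣
∣j-1+m∣≢∣j-m∣ zero    m       eq = 1+n≢n eq
∣j-1+m∣≢∣j-m∣ (suc j) zero    eq = 1+n≢n (sym (trans (sym (∣-∣-identityʳ j)) eq))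
∣j-1+m∣≢∣j-m∣ (suc j) (suc m) eq = ∣j-1+m∣≢∣j-m∣ j m eq

-- Distances from `j` to consecutive numbers differ in parity, so numbers at most one apart and
-- equally far from `j` coincide.
∣-∣-spread : ∀ {j m m'} → m ≤ suc m' → m' ≤ suc m → ∣ j - m ∣ ≡ ∣ j - m' ∣ → m ≡ m'
∣-∣-spread {j} {m} {m'} m≤ m'≤ eq with m≤n⇒m<n∨m≡n m≤ | m≤n⇒m<n∨m≡n m'≤
... | inj₂ refl | _         = contradiction eq (∣j-1+m∣≢∣j-m∣ j m')
... | _         | inj₂ refl = contradiction (sym eq) (∣j-1+m∣≢∣j-m∣ j m)
... | inj₁ m<   | inj₁ m'<  = ≤-antisym (s≤s⁻¹ m<) (s≤s⁻¹ m'<)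

-- The colouring is locating

module UpperBound (n t : ℕ) (N≤ : 2 + n ≤ 4 * 3 ^ t) where

  private
    N = 2 + n
    G = Olive N

  hueV : OliveV N → ℕ
  hueV hub        = 0
  hueV (node i j) = hue (toℕ i) (toℕ j)

  hueV< : ∀ v → hueV v < t + 3
  hueV< hub        = m≤n⇒m≤o+n t (s≤s z≤n)
  hueV< (node i j) = hue< (toℕ j) (≤-trans (Fin.toℕ<n i) N≤)

  c : OliveV N → Fin (t + 3)
  c v = fromℕ< (hueV< v)

  toℕ-c : ∀ v → toℕ (c v) ≡ hueV v
  toℕ-c v = Fin.toℕ-fromℕ< (hueV< v)

  Hue : ℕ → OliveV N → Set
  Hue a v = hueV v ≡ a

  Edge-proper : ∀ {u v} → OliveEdge N u v → hueV u ≢ hueV v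
  Edge-proper (hub-first i j j≡0) eq rewrite j≡0 = fill-0≢0 (toℕ i mod 4) (sym eq)
  Edge-proper (step i j j' j'≡1+j) eq rewrite j'≡1+j = hue-proper (toℕ i) (toℕ j) eq

  proper : IsColoring G (t + 3) c
  proper u v (inj₁ e) eq = Edge-proper e (trans (sym (toℕ-c u)) (trans (cong toℕ eq) (toℕ-c v)))
  proper u v (inj₂ e) eq = Edge-proper e (trans (sym (toℕ-c v)) (trans (cong toℕ (sym eq)) (toℕ-c u)))

  _≈_ : OliveV N → OliveV N → Set
  u ≈ v = SameCode G (t + 3) c u v

  transfer : ∀ {u v a d} → u ≈ v → a < t + 3 → IsDistSet G u (Hue a) d → IsDistSet G v (Hue a) d
  transfer {u} {v} {a} {d} u≈v a< dist =
    IsDistSet-cong class⇒hue hue⇒class (to (u≈v i d) (IsDistSet-cong hue⇒class class⇒hue dist))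
    where
    i = fromℕ< a<
    hue⇒class : ∀ w → Hue a w → c w ≡ i
    hue⇒class w eq = Fin.toℕ-injective (trans (toℕ-c w) (trans eq (sym (Fin.toℕ-fromℕ< a<))))
    class⇒hue : ∀ w → c w ≡ i → Hue a w
    class⇒hue w eq = trans (sym (toℕ-c w)) (trans (cong toℕ eq) (Fin.toℕ-fromℕ< a<))

  hubdist : ℕ → ℕ
  hubdist zero    = 0
  hubdist (suc _) = 1

  -- With at least two branches, the first two put the colours 1 and 2 next to the hub.
  via-hub : ∀ v b → ∃ λ w → Hue (missing b) w × Walk G v w (depth v + hubdist (missing b))
  via-hub v 0F = node 1F zero , refl , (to-hub v ++ʷ hub⇝node 1F zero)
  via-hub v 1F = node 0F zero , refl , (to-hub v ++ʷ hub⇝node 0F zero)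
  via-hub v 2F = hub , refl , (to-hub v ++ʷ [])
  via-hub v 3F = hub , refl , (to-hub v ++ʷ [])

  base< : ∀ b → missing b < t + 3
  base< b = m≤n⇒m≤o+n t (missing<3 b)

  -- The branch lacks this colour, so every walk to it passes the hub and the route of `via-hub` is
  -- shortest.
  dist-missing : ∀ (i : Fin N) j → let b = toℕ i mod 4 in
                 IsDistSet G (node i j) (Hue (missing b)) (suc (toℕ j) + hubdist (missing b))
  dist-missing i j = via-hub (node i j) b , λ v m eq w →
    ≤-trans (+-monoʳ-≤ (suc (toℕ j)) (far v eq))
      (Walk-leaving-≥ (λ { j' refl → hue≢missing (toℕ i) (toℕ j') eq }) w)
    where
    b = toℕ i mod 4
    far : ∀ v → Hue (missing b) v → hubdist (missing b) ≤ depth v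
    far hub        eq rewrite sym eq = z≤n
    far (node _ _) eq with missing b
    ... | zero  = z≤n
    ... | suc _ = s≤s z≤n

  -- To the colour missing on the branch of `u`, the distance from `u` is `depth u` plus that from
  -- the hub; from `v` it is at most `depth v` plus the same amount.
  ≈⇒depth≤ : ∀ u v → u ≈ v → depth u ≤ depth v
  ≈⇒depth≤ hub        v u≈v = z≤n
  ≈⇒depth≤ (node i j) v u≈v with via-hub v (toℕ i mod 4)
  ... | w , eq , walk = +-cancelʳ-≤ _ _ _
    (proj₂ (transfer u≈v (base< (toℕ i mod 4)) (dist-missing i j)) w _ eq walk)

  -- Otherwise one of the first two vertices of the other branch shows the colour, at most
  -- `suc (toℕ j')` steps away, one fewer than the route through the hub. Colour 0 is set apart
  -- because the hub itself carries it.
  ≈⇒missing : ∀ {i i' : Fin N} {j j'} → node i j ≈ node i' j' → toℕ j ≡ toℕ j' →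
              let b = toℕ i mod 4; b' = toℕ i' mod 4 in missing b ≢ 0 → missing b ≡ missing b'
  ≈⇒missing {i} {i'} {j} {j'} u≈v j≡j' ≢0 with missing (toℕ i mod 4) ≟ missing (toℕ i' mod 4)
  ... | yes eq = eq
  ... | no ≢m with hue-contains (toℕ i mod 4) (toℕ i') ≢0 ≢m
  ...   | e , e≤1 , e≤i' , eq = contradiction (begin
    2 + toℕ j                                     ≡⟨ +-comm 1 (suc (toℕ j)) ⟩
    suc (toℕ j) + 1                               ≡⟨ cong (suc (toℕ j) +_) (hubdist≡1 _ ≢0) ⟨
    suc (toℕ j) + hubdist (missing (toℕ i mod 4)) ≤⟨ proj₂ (transfer u≈v (base< (toℕ i mod 4)) (dist-missing i j))
                                                     (node i' e') _ eq' (node⇝node i' j' e') ⟩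
    ∣ toℕ j' - toℕ e' ∣                           ≤⟨ ∣m-n∣≤m⊔n (toℕ j') (toℕ e') ⟩
    toℕ j' ⊔ toℕ e'                               ≤⟨ ⊔-lub (n≤1+n (toℕ j'))
                                                       (≤-trans (≤-reflexive toℕ-e') (≤-trans e≤1 (s≤s z≤n))) ⟩
    suc (toℕ j')                                  ≡⟨ cong suc j≡j' ⟨
    suc (toℕ j)                                   ∎) (<⇒≱ ≤-refl)
    where
    open ≤-Reasoning
    e' = fromℕ< (s≤s e≤i')
    toℕ-e' : toℕ e' ≡ e
    toℕ-e' = Fin.toℕ-fromℕ< (s≤s e≤i')
    eq' : hue (toℕ i') (toℕ e') ≡ missing (toℕ i mod 4)
    eq' = trans (cong (hue (toℕ i')) toℕ-e') eq
    hubdist≡1 : ∀ m → m ≢ 0 → hubdist m ≡ 1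
    hubdist≡1 zero    ≢0 = contradiction refl ≢0
    hubdist≡1 (suc m) _  = refl

  hue-neighbours : ∀ {i : Fin N} {j v} → OliveAdj N (node i j) v →
                   hueV v ≡ 0 ⊎ hueV v ≡ fill (toℕ i mod 4) (suc (toℕ j)) ⊎ 3 ≤ hueV v
  hue-neighbours {i} (inj₁ (step _ j j' eq)) with hue-view (toℕ i) (toℕ j')
  ... | inj₁ e           = inj₂ (inj₁ (trans e (cong (fill (toℕ i mod 4)) eq)))
  ... | inj₂ (r , _ , e) = inj₂ (inj₂ (subst (3 ≤_) (sym e) (m≤n+m 3 r)))
  hue-neighbours (inj₂ (hub-first _ _ _)) = inj₁ refl
  hue-neighbours {i} (inj₂ (step _ j' j eq)) with hue-view (toℕ i) (toℕ j')
  ... | inj₁ e           = inj₂ (inj₁ (trans e (cong (fill (toℕ i mod 4) ∘ suc) (sym eq))))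
  ... | inj₂ (r , _ , e) = inj₂ (inj₂ (subst (3 ≤_) (sym e) (m≤n+m 3 r)))

  -- When the filler of the pair lies outwards, `SpecialAt-fits` guarantees that the branch reaches
  -- it.
  filler-neighbour : ∀ {i : Fin N} {j r} → SpecialAt (toℕ i) r (toℕ j) →
                     ∃ λ v → OliveAdj N (node i j) v × hueV v ≡ fill (toℕ i mod 4) (suc (toℕ j))
  filler-neighbour {i} {j} s@(m , j≡2+m , x) with Special-neighbour {toℕ i mod 4} 3 x
  ... | inj₁ eq = node i j⁺ , inj₁ (step i j j⁺ toℕ-j⁺) ,
      trans (cong (hue (toℕ i)) (trans toℕ-j⁺ (cong suc j≡2+m)))
        (trans eq (cong (fill (toℕ i mod 4) ∘ suc) (sym j≡2+m)))
    where
    j⁺ = fromℕ< (s≤s (SpecialAt-fits s))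
    toℕ-j⁺ = Fin.toℕ-fromℕ< (s≤s (SpecialAt-fits s))
  filler-neighbour {i} {suc j} s@(m , j≡2+m , x) | inj₂ (m' , refl , eq) =
    node i (inject₁ j) , inj₂ (step i (inject₁ j) (suc j) (cong suc (sym (Fin.toℕ-inject₁ j)))) ,
      trans (cong (hue (toℕ i)) (trans (Fin.toℕ-inject₁ j) j≡)) (trans eq (cong (fill (toℕ i mod 4)) (sym j≡)))
    where
    j≡ : toℕ j ≡ 2 + m'
    j≡ = suc-injective j≡2+m

  ≈⇒hue : ∀ u v → u ≈ v → hueV u ≡ hueV v
  ≈⇒hue u v u≈v with transfer u≈v (hueV< u) ((u , refl , []) , λ _ _ _ _ → z≤n)
  ... | (w , eq , []) , _ = sym eq

  -- Both types alternate 1 and 2, in opposite phase. A filler vertex betrays its type by its own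
  -- colour. A special vertex does so by its filler neighbour, whose colour never occurs next to a
  -- vertex of the other type at the same depth.
  types-2-3 : ∀ {i i' : Fin N} {j j'} → toℕ i mod 4 ≡ 2F → toℕ i' mod 4 ≡ 3F →
              toℕ j ≡ toℕ j' → ¬ (node i j ≈ node i' j')
  types-2-3 {i} {i'} {j} {j'} b≡2 b'≡3 j≡j' u≈v with hue-view (toℕ i) (toℕ j)
  types-2-3 {i} {i'} {j} {j'} b≡2 b'≡3 j≡j' u≈v | inj₁ e with hue-view (toℕ i') (toℕ j')
  ... | inj₁ e' rewrite b≡2 | b'≡3 = fill-2≢3 (toℕ j)
        (trans (sym e) (trans (≈⇒hue _ _ u≈v) (trans e' (cong (fill 3F) (sym j≡j')))))
  ... | inj₂ (r , _ , e') = fill≢special (toℕ i mod 4) (toℕ j) r (trans (sym e) (trans (≈⇒hue _ _ u≈v) e'))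
  types-2-3 {i} {i'} {j} {j'} b≡2 b'≡3 j≡j' u≈v | inj₂ (r , s , e) with filler-neighbour {i} {j} s
  ... | w , adj , hw = clash (transfer u≈v g< ((w , trans hw g≡ , adj ∷ []) , at-least-1))
    where
    g = fill 2F (suc (toℕ j))
    g≡ : fill (toℕ i mod 4) (suc (toℕ j)) ≡ g
    g≡ = cong (λ b → fill b (suc (toℕ j))) b≡2
    g< = m≤n⇒m≤o+n t (fill<3 2F (suc (toℕ j)))
    at-least-1 : ∀ v m → Hue g v → Walk G (node i j) v m → 1 ≤ m
    at-least-1 _ _ eq []      = contradiction (trans (sym eq) e) (fill≢special 2F (suc (toℕ j)) r)
    at-least-1 _ _ _  (_ ∷ _) = s≤s z≤n
    clash : ¬ IsDistSet G (node i' j') (Hue g) 1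
    clash ((v , eq , adj' ∷ []) , _) with hue-neighbours adj'
    ... | inj₁ v≡0 = fill≢missing 2F (suc (toℕ j)) (trans (sym eq) v≡0)
    ... | inj₂ (inj₁ v≡f) = fill-2≢3 (suc (toℕ j)) (trans (sym eq) (trans v≡f
            (cong₂ (λ b k → fill b (suc k)) b'≡3 (sym j≡j'))))
    ... | inj₂ (inj₂ 3≤v) = <⇒≱ (fill<3 2F (suc (toℕ j))) (subst (3 ≤_) eq 3≤v)

  ≈⇒type : ∀ {i i' : Fin N} {j j'} → node i j ≈ node i' j' → toℕ j ≡ toℕ j' → toℕ i mod 4 ≡ toℕ i' mod 4
  ≈⇒type {i} {i'} u≈v j≡j' with same-missing (toℕ i mod 4) (toℕ i' mod 4)
    (≈⇒missing {i} {i'} u≈v j≡j') (≈⇒missing {i'} {i} (SameCode-sym u≈v) (sym j≡j'))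
  ... | inj₁ eq = eq
  ... | inj₂ (inj₁ (b , b')) = contradiction u≈v (types-2-3 b b' j≡j')
  ... | inj₂ (inj₂ (b , b')) = contradiction (SameCode-sym u≈v) (types-2-3 b' b (sym j≡j'))

  -- If the own branch has the special colour, it is nearer there than on any other, since its
  -- position varies by at most one between branches. The distance is too short for a route through
  -- the hub, so the other vertex must also meet the colour on its own branch.
  ≈⇒Special : ∀ {i i' : Fin N} {j j' r m} → node i j ≈ node i' j' → toℕ j ≡ toℕ j' →
              SpecialAt (toℕ i) r m →
              ∃ λ m' → SpecialAt (toℕ i') r m' × ∣ toℕ j' - m' ∣ ≤ ∣ toℕ j - m ∣
  ≈⇒Special {i} {i'} {j} {j'} {r} {m} u≈v j≡j' s = found (transfer u≈v r+3< dist)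
    where
    m<1+i = s≤s (≤-trans (n≤1+n m) (SpecialAt-fits s))
    m̂ = fromℕ< m<1+i
    toℕ-m̂ : toℕ m̂ ≡ m
    toℕ-m̂ = Fin.toℕ-fromℕ< m<1+i
    hue-m̂ : hueV (node i m̂) ≡ r + 3
    hue-m̂ = hue-Special (subst (SpecialAt (toℕ i) r) (sym toℕ-m̂) s)
    r+3< : r + 3 < t + 3
    r+3< = subst (_< t + 3) hue-m̂ (hueV< (node i m̂))
    -- The own distance is at most j + m ≤ j + l + 1, one less than any route through the hub.
    across : ∀ {k p l} → SpecialAt p r l → suc (toℕ j) + suc l ≤ k → ∣ toℕ j - m ∣ < k
    across {k} {p} {l} s' le = begin-strict
      ∣ toℕ j - m ∣        ≤⟨ ∣m-n∣≤m⊔n (toℕ j) m ⟩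
      toℕ j ⊔ m            ≤⟨ m⊔n≤m+n (toℕ j) m ⟩
      toℕ j + m            ≤⟨ +-monoʳ-≤ (toℕ j) (SpecialAt-spread {toℕ i} {p} s s') ⟩
      toℕ j + suc l        <⟨ le ⟩
      k                    ∎
      where open ≤-Reasoning
    least-dist : ∀ v k → Hue (r + 3) v → Walk G (node i j) v k → ∣ toℕ j - m ∣ ≤ k
    least-dist hub k eq w = contradiction (trans eq (+-comm r 3)) (λ ())
    least-dist (node p l) k eq w with i Fin.≟ p
    ... | yes refl = subst (λ x → ∣ toℕ j - x ∣ ≤ k)
          (SpecialAt-unique {toℕ i} (hue-special {toℕ i} r eq) s) (Walk-within-≥ w)
    ... | no i≢p   = <⇒≤ (across {p = toℕ p} (hue-special {toℕ p} r eq) (Walk-across-≥ i≢p w))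
    dist : IsDistSet G (node i j) (Hue (r + 3)) ∣ toℕ j - m ∣
    dist = (node i m̂ , hue-m̂ ,
      subst (λ x → Walk G (node i j) (node i m̂) ∣ toℕ j - x ∣) toℕ-m̂ (node⇝node i j m̂)) , least-dist
    found : IsDistSet G (node i' j') (Hue (r + 3)) ∣ toℕ j - m ∣ →
            ∃ λ m' → SpecialAt (toℕ i') r m' × ∣ toℕ j' - m' ∣ ≤ ∣ toℕ j - m ∣
    found ((hub , eq , w) , _) = contradiction (trans eq (+-comm r 3)) (λ ())
    found ((node p l , eq , w) , _) with i' Fin.≟ p
    ... | yes refl = toℕ l , hue-special {toℕ p} r eq , Walk-within-≥ w
    ... | no i'≢p  = contradiction
      (across {p = toℕ p} (hue-special {toℕ p} r eq)
        (subst (λ x → suc x + suc (toℕ l) ≤ ∣ toℕ j - m ∣) (sym j≡j') (Walk-across-≥ i'≢p w)))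
      (<-irrefl refl)

  -- `≈⇒Special` in both directions gives equal distances from the common depth, and `∣-∣-spread`
  -- identifies the positions.
  ≈⇒same-Special : ∀ {i i' : Fin N} {j j' r m} → node i j ≈ node i' j' → toℕ j ≡ toℕ j' →
                   Special (toℕ i / 4) r m → Special (toℕ i' / 4) r m
  ≈⇒same-Special {i} {i'} {j} {j'} {r} {m} u≈v j≡j' x
    with s ← (m , refl , x)
    with ≈⇒Special {i} {i'} u≈v j≡j' s
  ... | m' , s'@(l , refl , y) , ≤₁ with ≈⇒Special {i'} {i} (SameCode-sym u≈v) (sym j≡j') s'
  -- The colour occurs once per branch, so the way back ends at the original position.
  ... | m'' , s'' , ≤₂ with refl ← SpecialAt-unique {toℕ i} s'' s =
    subst (Special (toℕ i' / 4) r) (suc-injective (suc-injective (∣-∣-spread {toℕ j}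
      (SpecialAt-spread {toℕ i'} {toℕ i} s' s) (SpecialAt-spread {toℕ i} {toℕ i'} s s')
      (≤-antisym (subst (λ k → ∣ k - 2 + l ∣ ≤ ∣ toℕ j - 2 + m ∣) (sym j≡j') ≤₁)
                 (subst (λ k → ∣ toℕ j - 2 + m ∣ ≤ ∣ k - 2 + l ∣) (sym j≡j') ≤₂))))) y

  locating : ∀ u v → u ≈ v → u ≡ v
  locating u v u≈v = same u v u≈v (≤-antisym (≈⇒depth≤ u v u≈v) (≈⇒depth≤ v u (SameCode-sym u≈v)))
    where
    same : ∀ u v → u ≈ v → depth u ≡ depth v → u ≡ v
    same hub hub _ _ = refl
    same (node i j) (node i' j') u≈v eq with j≡j' ← suc-injective eq
      with refl ← Fin.toℕ-injective {i = i} {i'} (mod-/-injective 4 (≈⇒type {i} {i'} u≈v j≡j')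
             (Special-injective (≈⇒same-Special {i} {i'} u≈v j≡j')
               (≈⇒same-Special {i'} {i} (SameCode-sym u≈v) (sym j≡j'))))
      = cong (node i) (Fin.toℕ-injective j≡j')

  colouring : HasLocatingColoring G (t + 3)
  colouring = c , proper , locating

theorem8 : (n : ℕ) → 2 ≤ n → (t : ℕ) → IsCeilLog3Quarter n t →
    IsLocChromNum (Olive n) (t + 3)
theorem8 (suc (suc n)) 2≤n t log@(n≤ , _) = UpperBound.colouring n t n≤ , colours-≥ 2≤n log
theorem8 (suc zero) (s≤s ()) _ _
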